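{- Let $G$ be a finite connected graph, $\Gamma$ a finite abelian group, and $\phi\colon V(G)\to\Gamma$ an isometric embedding of $G$ into $\mathrm{Cay}(\Gamma,S)$. Fix a generator $g\in S$. Then the set of edges of $G$ carrying $g$, taken with their forward orientations, has in-degree at most $1$ and out-degree at most $1$ at every vertex of $G$. Equivalently, every generator class is a partial permutation: a disjoint union of directed paths and directed cycles.
   Context: For a finite abelian group $\Gamma$ and a generating set $S\subseteq\Gamma\setminus\{0\}$ with $S=-S$, the Cayley graph $\mathrm{Cay}(\Gamma,S)$ has vertex set $\Gamma$ and an edge $\{h,h+s\}$ for each $h\in\Gamma$, $s\in S$; $d_\Gamma$ is its graph metric. An isometric embedding of $G$ into $\mathrm{Cay}(\Gamma,S)$ is an injection $\phi\colon V(G)\to\Gamma$ with $d_\Gamma(\phi(u),\phi(v))=d_G(u,v)$ for all $u,v$, where $d_G$ is the shortest-path metric. An edge $\{u,v\}$ of $G$ carries the generator $g$ if $\phi(v)-\phi(u)=\pm g$; its forward orientation is $u\to v$ when $\phi(v)-\phi(u)=g$ (if $g=-g$, either orientation is a forward orientation). The generator class of $g$ is the set of edges carrying $g$, with forward orientations. -}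

module Defs where

open import Algebra.Bundles using (AbelianGroup)
import Algebra.Properties.AbelianGroup as AbelianGroupProperties
open import Data.Fin.Base using (Fin)
import Data.Fin.Properties as Fin
open import Data.List.Base
  using (List; []; _∷_; _∷ʳ_; zip; length; filter; allFin; concatMap)
open import Data.List.Membership.Propositional using (_∈_)
open import Data.List.Relation.Binary.Permutation.Propositional using (_↭_)
open import Data.Maybe.Base using (Maybe; just)
open import Data.Nat.Base using (ℕ; zero; suc; _≤_)
open import Data.Product.Base using (∃; ∃-syntax; _×_; _,_; proj₁)
open import Data.Sum.Base using (_⊎_)
open import Function.Base using (_∘_)
open import Function.Bundles using (Inverse; _⇔_)
open import Function.Definitions using (Injective)
open import Function.Properties.Inverse using (Inverse⇒Injection)
open import Level using (Level; _⊔_) renaming (suc to lsuc)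
open import Relation.Binary.Bundles using (Setoid)
open import Relation.Binary.Core using (Rel)
open import Relation.Binary.Definitions
  using (Decidable; Symmetric; _Respects₂_)
open import Relation.Binary.PropositionalEquality using (_≡_; setoid)
import Relation.Binary.Reasoning.Setoid as SetoidReasoning
open import Relation.Nullary.Decidable using (_×-dec_; _⊎-dec_; via-injection)
open import Relation.Nullary.Negation using (¬_)
open import Relation.Unary using (Pred; _≐_; _∉_) renaming (_∈_ to _∈ᵖ_)

private variable
  a c ℓ s : Level
  n : ℕ

Finite : Setoid c ℓ → Set (c ⊔ ℓ)
Finite A = ∃[ m ] Inverse A (setoid (Fin m))

record Graph (V : Setoid c ℓ) a : Set (c ⊔ ℓ ⊔ lsuc a) where
  open Setoid V using (Carrier; _≈_)
  field
    Adj    : Rel Carrier a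
    resp   : Adj Respects₂ _≈_
    sym    : Symmetric Adj
    irrefl : ∀ {u v} → u ≈ v → ¬ Adj u v

module _ {V : Setoid c ℓ} (G : Graph V a) where
  open Setoid V using (Carrier; _≈_)
  open Graph G using (Adj)

  data Walk : Carrier → Carrier → ℕ → Set (c ⊔ ℓ ⊔ a) where
    stop : ∀ {u v} → u ≈ v → Walk u v zero
    step : ∀ {u v w k} → Adj u v → Walk v w k → Walk u w (suc k)

  Connected : Set (c ⊔ ℓ ⊔ a)
  Connected = ∀ u v → ∃[ k ] Walk u v k

  -- The shortest-path metric, as a relation: the distance from u to v is k.
  IsDistance : Carrier → Carrier → ℕ → Set (c ⊔ ℓ ⊔ a)
  IsDistance u v k = Walk u v k × (∀ {l} → Walk u v l → k ≤ l)

-- A group Γ is written additively throughout.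
module _ (Γ : AbelianGroup c ℓ) where
  open AbelianGroup Γ
    using (Carrier; _≈_)
    renaming (_∙_ to _+_; ε to 0#; _⁻¹ to -_)

  data ⟨_⟩ (S : Pred Carrier s) : Pred Carrier (c ⊔ ℓ ⊔ s) where
    gen      : ∀ {x} → x ∈ᵖ S → x ∈ᵖ ⟨ S ⟩
    0-closed : 0# ∈ᵖ ⟨ S ⟩
    +-closed : ∀ {x y} → x ∈ᵖ ⟨ S ⟩ → y ∈ᵖ ⟨ S ⟩ → (x + y) ∈ᵖ ⟨ S ⟩
    -‿closed : ∀ {x} → x ∈ᵖ ⟨ S ⟩ → (- x) ∈ᵖ ⟨ S ⟩
    ≈-closed : ∀ {x y} → x ≈ y → x ∈ᵖ ⟨ S ⟩ → y ∈ᵖ ⟨ S ⟩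

  record IsConnectionSet (S : Pred Carrier s) : Set (c ⊔ ℓ ⊔ s) where
    field
      resp       : ∀ {x y} → x ≈ y → x ∈ᵖ S → y ∈ᵖ S
      nonzero    : 0# ∉ S
      symmetric  : S ≐ (S ∘ -_)
      generating : ∀ x → x ∈ᵖ ⟨ S ⟩

module _ (Γ : AbelianGroup c ℓ) {S : Pred (AbelianGroup.Carrier Γ) s}
         (isConn : IsConnectionSet Γ S) where
  open AbelianGroup Γ
    using (Carrier; _≈_; trans; ∙-congʳ; ∙-congˡ; assoc; inverseʳ; identityʳ)
    renaming (setoid to Γ-setoid; sym to ≈-sym; _∙_ to _+_; ε to 0#; _⁻¹ to -_)
  open AbelianGroupProperties Γ using (identityʳ-unique)
  private module S = IsConnectionSet isConn

  Cay : Graph Γ-setoid (c ⊔ ℓ ⊔ s)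
  Cay = record
    { Adj    = Adj
    ; resp   = (λ y≈z (t , t∈S , e) → t , t∈S , trans (≈-sym y≈z) e)
             , (λ y≈z (t , t∈S , e) → t , t∈S , trans e (∙-congʳ y≈z))
    ; sym    = Adj-sym
    ; irrefl = λ {u} u≈v (t , t∈S , e) →
        S.nonzero (S.resp (identityʳ-unique u t (≈-sym (trans u≈v e))) t∈S)
    }
    where
    Adj : Rel Carrier _
    Adj h h′ = ∃[ t ] t ∈ᵖ S × h′ ≈ h + t

    Adj-sym : Symmetric Adj
    Adj-sym {h} {h′} (t , t∈S , e) = - t , proj₁ S.symmetric t∈S , (begin
      h               ≈⟨ identityʳ h ⟨
      h + 0#          ≈⟨ ∙-congˡ (inverseʳ t) ⟨
      h + (t + - t)   ≈⟨ assoc h t (- t) ⟨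
      (h + t) + - t   ≈⟨ ∙-congʳ e ⟨
      h′ + - t        ∎)
      where open SetoidReasoning Γ-setoid

  record IsIsometricEmbedding (G : Graph (setoid (Fin n)) a) (φ : Fin n → Carrier)
                              : Set (a ⊔ c ⊔ ℓ ⊔ s) where
    field
      injective : Injective _≡_ _≈_ φ
      isometric : ∀ u v k → IsDistance G u v k ⇔ IsDistance Cay (φ u) (φ v) k

module _ (Γ : AbelianGroup c ℓ) (G : Graph (setoid (Fin n)) a)
         (φ : Fin n → AbelianGroup.Carrier Γ) (g : AbelianGroup.Carrier Γ) where
  open AbelianGroup Γ using (_≈_; _-_) renaming (setoid to Γ-setoid; _⁻¹ to -_)
  open Graph G using (Adj)

  Carries : Rel (Fin n) ℓ
  Carries u v = (φ v - φ u) ≈ g ⊎ (φ v - φ u) ≈ (- g)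

  -- The arcs u → v of the class of g.  When g ≈ - g, both orientations of an
  -- edge carrying g are forward, so such an edge gives two opposite arcs.
  GeneratorClass : Rel (Fin n) (a ⊔ ℓ)
  GeneratorClass u v = (Adj u v × Carries u v) × (φ v - φ u) ≈ g

  generatorClass? : Finite Γ-setoid → Decidable Adj → Decidable GeneratorClass
  generatorClass? (_ , Γ↔Fin) adj? u v =
    (adj? u v ×-dec (((φ v - φ u) ≟ g) ⊎-dec ((φ v - φ u) ≟ (- g))))
      ×-dec ((φ v - φ u) ≟ g)
    where _≟_ = via-injection (Inverse⇒Injection Γ↔Fin) Fin._≟_

module _ {D : Rel (Fin n) a} (D? : Decidable D) where
  inDegree outDegree : Fin n → ℕ
  inDegree  v = length (filter (λ u → D? u v) (allFin n))
  outDegree u = length (filter (λ v → D? u v) (allFin n))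

IsPartialPermutation : Rel (Fin n) a → Set a
IsPartialPermutation {n} D = ∃ λ (f : Fin n → Maybe (Fin n)) →
  (∀ u v → D u v ⇔ f u ≡ just v) ×
  (∀ {u u′ v} → f u ≡ just v → f u′ ≡ just v → u ≡ u′)

-- Paths may consist of a single vertex; cycles have length at least two.
data Component (A : Set a) : Set a where
  path  : A → List A → Component A
  cycle : A → A → List A → Component A

module _ {A : Set a} where
  vertices : Component A → List A
  vertices (path u vs)    = u ∷ vs
  vertices (cycle u v vs) = u ∷ v ∷ vs

  arcs : Component A → List (A × A)
  arcs (path u vs)    = zip (u ∷ vs) vs
  arcs (cycle u v vs) = zip (u ∷ v ∷ vs) (v ∷ vs ∷ʳ u)

-- Being a permutation of allFin n, which has no repetitions, makes each
-- component simple, the components pairwise disjoint, and their union spanning.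
IsDisjointUnionOfPathsAndCycles : Rel (Fin n) a → Set a
IsDisjointUnionOfPathsAndCycles {n} D = ∃ λ (cs : List (Component (Fin n))) →
  concatMap vertices cs ↭ allFin n ×
  (∀ u v → D u v ⇔ (u , v) ∈ concatMap arcs cs)

{-# OPTIONS --safe #-}

-- Two arcs of the class of g with a common endpoint differ by the same group
-- element g, so injectivity of φ identifies their other endpoints.  The
-- decomposition into paths and cycles is built by adding the arcs one at a time
-- to the union of all one-vertex paths: a new arc u → v starts at the last
-- vertex of a path and ends at the first vertex of a path, so it either closes
-- a path into a cycle or joins two paths.

module Submission where

open import Defs
open import Algebra.Bundles using (AbelianGroup)
import Algebra.Properties.AbelianGroup as AbelianGroupProperties
open import Data.Fin.Base using (Fin)
import Data.Fin.Properties as Fin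
open import Data.List.Base
  using (List; []; _∷_; [_]; _++_; _∷ʳ_; map; zip; length; filter; allFin; concatMap;
         cartesianProduct)
open import Data.List.Membership.Propositional using (_∈_; _∉_; find)
open import Data.List.Membership.Propositional.Properties
  using (∈-∃++; ∈-++⁺ˡ; ∈-++⁺ʳ; ∈-++⁻; ∈-concatMap⁻; ∈-filter⁺; ∈-filter⁻;
         ∈-cartesianProduct⁺; ∈-allFin)
open import Data.List.Properties using (++-assoc; ++-identityʳ; concatMap-map; concatMap-pure)
open import Data.List.Relation.Binary.Permutation.Propositional
  using (_↭_; refl; prep; swap; trans; ↭-refl; ↭-sym; ↭-trans; ↭-reflexive;
         module PermutationReasoning)
open import Data.List.Relation.Binary.Permutation.Propositional.Properties
  using (∈-resp-↭; shift; shifts; ++⁺ˡ)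
open import Data.List.Relation.Unary.All using (All; []; _∷_; lookup)
open import Data.List.Relation.Unary.All.Properties using (all-filter)
open import Data.List.Relation.Unary.Any using (here; there)
open import Data.List.Relation.Unary.AllPairs using ([]; _∷_)
open import Data.List.Relation.Unary.Unique.Propositional using (Unique)
import Data.List.Relation.Unary.Unique.Propositional.Properties as Unique
open import Data.Maybe.Base using (Maybe; just)
import Data.Maybe.Base as Maybe
open import Data.Nat.Base using (ℕ; _≤_; z≤n; s≤s)
open import Data.Product.Base using (∃; ∃₂; _×_; _,_; proj₁; proj₂; uncurry)
open import Data.Sum.Base using (_⊎_; inj₁; inj₂)
open import Function.Base using (_∘_)
open import Function.Bundles using (mk⇔)
open import Level using (Level)
open import Relation.Binary.Core using (Rel)
open import Relation.Binary.Definitions using (Decidable)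
open import Relation.Binary.PropositionalEquality
  using (_≡_; _≢_; refl; sym; cong; setoid)
import Relation.Binary.PropositionalEquality as ≡
open import Relation.Nullary.Decidable using (yes; no; dec⇒maybe)
open import Relation.Nullary.Negation using (contradiction)
open import Relation.Unary using (Pred) renaming (_∈_ to _∈ᵖ_)
import Relation.Unary as Unary

private variable
  a b r : Level
  A : Set a
  B : Set b
  n : ℕ

-- Concatenations up to permutation

concatMap-↭ : (f : A → List B) {xs ys : List A} → xs ↭ ys → concatMap f xs ↭ concatMap f ys
concatMap-↭ f refl         = ↭-refl
concatMap-↭ f (prep x p)   = ++⁺ˡ (f x) (concatMap-↭ f p)
concatMap-↭ f (swap x y p) =
  ↭-trans (++⁺ˡ (f x) (++⁺ˡ (f y) (concatMap-↭ f p))) (shifts (f x) (f y))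
concatMap-↭ f (trans p q)  = ↭-trans (concatMap-↭ f p) (concatMap-↭ f q)

-- Moves the component that contains a given vertex to the front, where `add-arc` can replace it.
∈-concatMap-↭ : (f : A → List B) {xs : List A} {y : B} → y ∈ concatMap f xs →
                ∃₂ λ x xs′ → xs ↭ x ∷ xs′ × y ∈ f x
∈-concatMap-↭ f {xs} y∈ with find (∈-concatMap⁻ f {xs = xs} y∈)
... | x , x∈xs , y∈fx with ∈-∃++ x∈xs
... | ys , zs , refl = x , ys ++ zs , shift x ys zs , y∈fx

-- Arcs of paths and cycles

last : A → List A → A
last x []       = x
last x (y ∷ ys) = last y ys

-- The shorter second list truncates the `zip`, so only the final entry has no partner to its right.
is-last-or-source : ∀ {x : A} w ws → x ∈ w ∷ ws →
                    x ≡ last w ws ⊎ ∃ λ y → (x , y) ∈ zip (w ∷ ws) ws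
is-last-or-source w []       (here refl) = inj₁ refl
is-last-or-source w (y ∷ ys) (here refl) = inj₂ (y , here refl)
is-last-or-source w (y ∷ ys) (there x∈) with is-last-or-source y ys x∈
... | inj₁ e       = inj₁ e
... | inj₂ (z , i) = inj₂ (z , there i)

is-target : ∀ {x : A} w ws → x ∈ ws → ∃ λ y → (y , x) ∈ zip (w ∷ ws) ws
is-target w (y ∷ ys) (here refl) = w , here refl
is-target w (y ∷ ys) (there x∈) with is-target y ys x∈
... | z , i = z , there i

-- `xs` is kept independent of `y ∷ ys` so that one identity covers both uses: closing a path, where
-- `xs` and `ys` are empty and `y` is the first vertex, and joining two paths, where `xs` is
-- `y ∷ ys`.
zip-++ : ∀ (w : A) ws xs y ys →
         zip (w ∷ ws ++ xs) (ws ++ y ∷ ys) ≡ zip (w ∷ ws) ws ++ (last w ws , y) ∷ zip xs ys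
zip-++ w []       xs y ys = refl
zip-++ w (v ∷ vs) xs y ys = cong ((w , v) ∷_) (zip-++ v vs xs y ys)

arcs-cycle : ∀ (u v : A) vs →
             arcs (cycle u v vs) ≡ arcs (path u (v ∷ vs)) ∷ʳ (last v vs , u)
arcs-cycle u v vs = ≡.trans
  (cong (λ ws → zip (u ∷ v ∷ ws) (v ∷ vs ∷ʳ u)) (sym (++-identityʳ vs)))
  (zip-++ u (v ∷ vs) [] u [])

arcs-join : ∀ (w : A) ws v vs →
            arcs (path w (ws ++ v ∷ vs)) ≡
            arcs (path w ws) ++ (last w ws , v) ∷ arcs (path v vs)
arcs-join w ws v vs = zip-++ w ws (v ∷ vs) v vs

-- On a cycle the closing arc gives even the last listed vertex a successor, so only the end of a
-- path remains.
no-successor : ∀ {u : A} C → u ∈ vertices C → (∀ x → (u , x) ∉ arcs C) →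
               ∃₂ λ w ws → C ≡ path w ws × u ≡ last w ws
no-successor (path w ws) u∈ ∉arcs with is-last-or-source w ws u∈
... | inj₁ u≡last  = w , ws , refl , u≡last
... | inj₂ (x , i) = contradiction i (∉arcs x)
no-successor (cycle w y ys) u∈ ∉arcs rewrite arcs-cycle w y ys
  with is-last-or-source w (y ∷ ys) u∈
... | inj₁ refl    = contradiction (∈-++⁺ʳ (arcs (path w (y ∷ ys))) (here refl)) (∉arcs w)
... | inj₂ (x , i) = contradiction (∈-++⁺ˡ i) (∉arcs x)

-- Dually, the closing arc of a cycle enters its first listed vertex, so only the start of a path
-- remains.
no-predecessor : ∀ {v : A} C → v ∈ vertices C → (∀ x → (x , v) ∉ arcs C) →
                 ∃ λ vs → C ≡ path v vs
no-predecessor (path w ws) (here refl) ∉arcs = ws , refl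
no-predecessor (path w ws) (there v∈) ∉arcs with is-target w ws v∈
... | x , i = contradiction i (∉arcs x)
no-predecessor (cycle w y ys) v∈ ∉arcs rewrite arcs-cycle w y ys
  with v∈
... | here refl = contradiction (∈-++⁺ʳ (arcs (path w (y ∷ ys))) (here refl)) (∉arcs (last y ys))
... | there v∈′ with is-target w (y ∷ ys) v∈′
...   | x , i = contradiction (∈-++⁺ˡ i) (∉arcs x)

-- Adding one arc

arcs⊆ : ∀ {cs cs′} {e : A × A} → cs ↭ cs′ → e ∈ concatMap arcs cs′ → e ∈ concatMap arcs cs
arcs⊆ cs↭ = ∈-resp-↭ (↭-sym (concatMap-↭ arcs cs↭))

-- The case split is on whether `v` lies on the path that ends at `u`. The hypothesis `u ≢ v` rules
-- out a loop on a one-vertex path, which `cycle` cannot represent.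
add-arc : ∀ {u v : A} cs → u ∈ concatMap vertices cs → v ∈ concatMap vertices cs → u ≢ v →
          (∀ x → (u , x) ∉ concatMap arcs cs) → (∀ x → (x , v) ∉ concatMap arcs cs) →
          ∃ λ cs′ → concatMap vertices cs′ ↭ concatMap vertices cs ×
                    concatMap arcs cs′ ↭ (u , v) ∷ concatMap arcs cs
add-arc {u = u} {v} cs u∈ v∈ u≢v u↛ ↛v
  with C , rest , cs↭ , u∈C ← ∈-concatMap-↭ vertices u∈
  with w , ws , refl , refl ← no-successor C u∈C (λ x → u↛ x ∘ arcs⊆ cs↭ ∘ ∈-++⁺ˡ)
  with ∈-++⁻ (w ∷ ws) (∈-resp-↭ (concatMap-↭ vertices cs↭) v∈)
... | inj₁ v∈C = close ws cs↭ u≢v (proj₂ (no-predecessor _ v∈C (λ x → ↛v x ∘ arcs⊆ cs↭ ∘ ∈-++⁺ˡ)))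
  where
  -- The equation of paths says that `v` is the first vertex `w`. Abstracting over `ws` separates
  -- the one-vertex path, where `w` is also the last vertex, from the longer paths that become
  -- cycles.
  close : ∀ ws → cs ↭ path w ws ∷ rest → last w ws ≢ v → ∀ {vs} → path w ws ≡ path v vs →
          ∃ λ cs′ → concatMap vertices cs′ ↭ concatMap vertices cs ×
                    concatMap arcs cs′ ↭ (last w ws , v) ∷ concatMap arcs cs
  close []       _   w≢v refl = contradiction refl w≢v
  close (y ∷ ys) cs↭ _   refl =
    -- The new cycle and the old path have the same vertex list by definition.
    cycle w y ys ∷ rest , ↭-sym (concatMap-↭ vertices cs↭) , (begin
      arcs (cycle w y ys) ++ es  ≡⟨ cong (_++ es) (arcs-cycle w y ys) ⟩
      (p ∷ʳ e) ++ es             ≡⟨ ++-assoc p [ e ] es ⟩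
      p ++ e ∷ es                ↭⟨ shift e p es ⟩
      e ∷ p ++ es                ↭⟨ prep e (concatMap-↭ arcs cs↭) ⟨
      e ∷ concatMap arcs cs      ∎)
    where
    open PermutationReasoning
    p  = arcs (path w (y ∷ ys))
    e  = last y ys , w
    es = concatMap arcs rest
... | inj₂ v∈rest
  with D , rest′ , rest↭ , v∈D ← ∈-concatMap-↭ vertices v∈rest
  -- With both components at the front, the join replaces these two and keeps `rest′`.
  with cs↭′ ← ↭-trans cs↭ (prep (path w ws) rest↭)
  with vs , refl ← no-predecessor D v∈D
    (λ x → ↛v x ∘ arcs⊆ cs↭′ ∘ ∈-++⁺ʳ (arcs (path w ws)) ∘ ∈-++⁺ˡ)
  = path w (ws ++ v ∷ vs) ∷ rest′ , vertices↭ , arcs↭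
  where
  open PermutationReasoning
  p  = arcs (path w ws)
  q  = arcs (path v vs)
  e  = last w ws , v
  es = concatMap arcs rest′

  vertices↭ : (w ∷ ws ++ v ∷ vs) ++ concatMap vertices rest′ ↭ concatMap vertices cs
  vertices↭ = begin
    (w ∷ ws ++ v ∷ vs) ++ concatMap vertices rest′    ≡⟨ ++-assoc (w ∷ ws) (v ∷ vs) _ ⟩
    (w ∷ ws) ++ (v ∷ vs) ++ concatMap vertices rest′  ↭⟨ concatMap-↭ vertices cs↭′ ⟨
    concatMap vertices cs                             ∎

  arcs↭ : arcs (path w (ws ++ v ∷ vs)) ++ es ↭ e ∷ concatMap arcs cs
  arcs↭ = begin
    arcs (path w (ws ++ v ∷ vs)) ++ es  ≡⟨ cong (_++ es) (arcs-join w ws v vs) ⟩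
    (p ++ e ∷ q) ++ es                  ≡⟨ ++-assoc p (e ∷ q) es ⟩
    p ++ e ∷ q ++ es                    ↭⟨ shift e p (q ++ es) ⟩
    e ∷ p ++ q ++ es                    ↭⟨ prep e (concatMap-↭ arcs cs↭′) ⟨
    e ∷ concatMap arcs cs               ∎

-- Decomposition into paths and cycles

module _ {D : Rel A r}
         (functional  : ∀ {u v v′} → D u v → D u v′ → v ≡ v′)
         (injective   : ∀ {u u′ v} → D u v → D u′ v → u ≡ u′)
         (irreflexive : ∀ {u v} → D u v → u ≢ v)
         where

  -- Induction on the list of arcs. Since `xs` contains every element of `A`, both ends of a new arc
  -- already lie on components.
  components : ∀ xs → (∀ x → x ∈ xs) → ∀ es → Unique es → All (uncurry D) es →
               ∃ λ cs → concatMap vertices cs ↭ xs × concatMap arcs cs ↭ es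
  components xs _ [] _ _ =
      map (λ x → path x []) xs
    , ↭-reflexive (≡.trans (concatMap-map vertices (λ x → path x []) xs) (concatMap-pure xs))
    , ↭-reflexive (no-arcs xs)
    where
    no-arcs : ∀ xs → concatMap arcs (map (λ (x : A) → path x []) xs) ≡ []
    no-arcs []       = refl
    no-arcs (x ∷ xs) = no-arcs xs
  components xs ∈xs ((u , v) ∷ es) (e∉es ∷ unique) (d ∷ ds)
    with cs , vs↭ , es↭ ← components xs ∈xs es unique ds
    with cs′ , vs′↭ , es′↭ ← add-arc cs
      (∈-resp-↭ (↭-sym vs↭) (∈xs u)) (∈-resp-↭ (↭-sym vs↭) (∈xs v)) (irreflexive d)
      -- An arc from `u` already present would, by functionality, be `(u , v)` itself, against the
      -- uniqueness of the list; injectivity does the same for arcs into `v`.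
      (λ x i → let i′ = ∈-resp-↭ es↭ i in
        lookup e∉es i′ (cong (u ,_) (functional d (lookup ds i′))))
      (λ x i → let i′ = ∈-resp-↭ es↭ i in
        lookup e∉es i′ (cong (_, v) (injective d (lookup ds i′))))
    = cs′ , ↭-trans vs′↭ vs↭ , ↭-trans es′↭ (prep (u , v) es↭)

-- Degrees, partial permutations and finite enumeration

length≤1 : ∀ {P : Pred A r} → (∀ {x y} → P x → P y → x ≡ y) →
           ∀ {xs} → Unique xs → All P xs → length xs ≤ 1
length≤1 _  {[]}         _               _             = z≤n
length≤1 _  {_ ∷ []}     _               _             = s≤s z≤n
length≤1 ≡! {_ ∷ _ ∷ _} ((x≢y ∷ _) ∷ _) (px ∷ py ∷ _) = contradiction (≡! px py) x≢y

module _ {D : Rel (Fin n) r} (D? : Decidable D)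
         (functional  : ∀ {u v v′} → D u v → D u v′ → v ≡ v′)
         (injective   : ∀ {u u′ v} → D u v → D u′ v → u ≡ u′)
         where

  inDegree≤1 : ∀ v → inDegree D? v ≤ 1
  inDegree≤1 v =
    length≤1 injective (Unique.filter⁺ D?v (Unique.allFin⁺ n)) (all-filter D?v (allFin n))
    where
    D?v : Unary.Decidable (λ u → D u v)
    D?v u = D? u v

  outDegree≤1 : ∀ u → outDegree D? u ≤ 1
  outDegree≤1 u =
    length≤1 functional (Unique.filter⁺ (D? u) (Unique.allFin⁺ n)) (all-filter (D? u) (allFin n))

  isPartialPermutation : IsPartialPermutation D
  isPartialPermutation =
    f ,
    (λ u v → mk⇔ (complete u v) (sound u v)) ,
    λ {u} {u′} {v} e e′ → injective (sound u v e) (sound u′ v e′)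
    where
    f : Fin n → Maybe (Fin n)
    f u = Maybe.map proj₁ (dec⇒maybe (Fin.any? (D? u)))

    sound : ∀ u v → f u ≡ just v → D u v
    sound u v e with Fin.any? (D? u)
    sound u v refl | yes (_ , d) = d

    complete : ∀ u v → D u v → f u ≡ just v
    complete u v d with Fin.any? (D? u)
    -- The search returns some out-neighbour of `u`; functionality identifies it with `v`.
    ... | yes (_ , d′) = cong just (functional d′ d)
    ... | no ¬d        = contradiction (v , d) ¬d

  pairs : List (Fin n × Fin n)
  pairs = cartesianProduct (allFin n) (allFin n)

  isDisjointUnionOfPathsAndCycles : (∀ {u v} → D u v → u ≢ v) → IsDisjointUnionOfPathsAndCycles D
  isDisjointUnionOfPathsAndCycles irreflexive
    with cs , vs↭ , es↭ ← components functional injective irreflexive (allFin n) ∈-allFin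
      (filter (uncurry D?) pairs)
      (Unique.filter⁺ (uncurry D?) (Unique.cartesianProduct⁺ (Unique.allFin⁺ n) (Unique.allFin⁺ n)))
      (all-filter (uncurry D?) pairs)
    = cs , vs↭ , λ u v → mk⇔
        (λ d → ∈-resp-↭ (↭-sym es↭)
          (∈-filter⁺ (uncurry D?) (∈-cartesianProduct⁺ (∈-allFin u) (∈-allFin v)) d))
        (λ i → proj₂ (∈-filter⁻ (uncurry D?) {xs = pairs} (∈-resp-↭ es↭ i)))

-- Generator classes of an isometric embedding

proposition1 : ∀ {a c ℓ s : Level} {n : ℕ}
    (G : Graph (setoid (Fin n)) a) (adj? : Decidable (Graph.Adj G)) →
    Connected G →
    (Γ : AbelianGroup c ℓ) (finite : Finite (AbelianGroup.setoid Γ)) →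
    (S : Pred (AbelianGroup.Carrier Γ) s) (isConn : IsConnectionSet Γ S) →
    (φ : Fin n → AbelianGroup.Carrier Γ) → IsIsometricEmbedding Γ isConn G φ →
    (g : AbelianGroup.Carrier Γ) → g ∈ᵖ S →
    (∀ v → inDegree (generatorClass? Γ G φ g finite adj?) v ≤ 1 ×
    outDegree (generatorClass? Γ G φ g finite adj?) v ≤ 1) ×
    IsPartialPermutation (GeneratorClass Γ G φ g) ×
    IsDisjointUnionOfPathsAndCycles (GeneratorClass Γ G φ g)
proposition1 G adj? _ Γ finite S isConn φ embedding g _ =
  (λ v → inDegree≤1 class? functional injective v , outDegree≤1 class? functional injective v) ,
  isPartialPermutation class? functional injective ,
  isDisjointUnionOfPathsAndCycles class? functional injective
    -- Arcs of the class are edges of `G`, which has no loops.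
    (λ d u≡v → Graph.irrefl G u≡v (proj₁ (proj₁ d)))
  where
  open AbelianGroup Γ using () renaming (trans to ≈-trans; sym to ≈-sym)
  open AbelianGroupProperties Γ using (∙-cancelˡ; ∙-cancelʳ; ⁻¹-injective)
  module φ = IsIsometricEmbedding embedding
  class? = generatorClass? Γ G φ g finite adj?

  functional : ∀ {u v v′} → GeneratorClass Γ G φ g u v → GeneratorClass Γ G φ g u v′ → v ≡ v′
  -- The common term cancelled on the right is the negative of `φ u`.
  functional (_ , e) (_ , e′) = φ.injective (∙-cancelʳ _ _ _ (≈-trans e (≈-sym e′)))

  injective : ∀ {u u′ v} → GeneratorClass Γ G φ g u v → GeneratorClass Γ G φ g u′ v → u ≡ u′
  injective (_ , e) (_ , e′) =
    -- Here `φ v` cancels on the left, which leaves the negatives of `φ u` and `φ u′` equal.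
    φ.injective (⁻¹-injective (∙-cancelˡ _ _ _ (≈-trans e (≈-sym e′))))
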